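{- For all integers $n\ge \ell\ge 0$, $$\frac{1}{n+1}\binom{2n+2}{n-\ell}C_n=\sum_{k=0}^{n-\ell}\frac{(2k+1)(2k+\ell+2)(2k+2\ell+3)}{(2n+1)(2n+2)(2n+3)^2}\binom{2n+3}{n-k-\ell}\binom{2n+3}{n-k+1},$$ $$\frac{1}{n+1}\binom{2n+2}{n-\ell}C_{n+1}=\sum_{k=0}^{n-\ell}\frac{(2k+2)(2k+\ell+3)(2k+2\ell+4)}{(2n+2)(2n+3)(2n+4)^2}\binom{2n+4}{n-k-\ell}\binom{2n+4}{n-k+1},$$ $$\frac{1}{n+1}\binom{2n+2}{n-\ell}\binom{2n+1}{n}=\sum_{k=0}^{n-\ell}\frac{2k+\ell+2}{(2n+2)(2n+3)}\binom{2n+3}{n-k-\ell}\binom{2n+3}{n-k+1}.$$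
   Context: $C_n=\frac{1}{n+1}\binom{2n}{n}$ is the $n$-th Catalan number. -}

module Defs where

open import Data.Nat using (ℕ; suc; _*_)
open import Data.Nat.Combinatorics using (_C_)
open import Data.Integer using (+_)
open import Data.Rational using (ℚ; _/_; +-0-rawMonoid) renaming (_*_ to _·_)
open import Data.Fin using (toℕ)
open import Algebra.Definitions.RawMonoid +-0-rawMonoid using (sum)

fromℕ : ℕ → ℚ
fromℕ m = + m / 1

catalan : ℕ → ℚ
catalan n = (+ 1 / suc n) · fromℕ ((2 * n) C n)

-- The upper bound m is included: the index k takes the m + 1 values 0, …, m.
sumUpTo : ℕ → (ℕ → ℚ) → ℚ
sumUpTo m f = sum {suc m} (λ i → f (toℕ i))

infixr 5 sumUpTo
syntax sumUpTo m (λ k → e) = ∑[ k ≤ m ] e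

{-# OPTIONS --safe #-}

-- Write p = N − 1, a = n − k − ℓ, b = n − k + 1.  All three sums telescope: if
-- c x(k) + a b q(k+1) = (N − a)(N − b) q(k), then by absorption
-- c x(k) C(N,a) C(N,b) = N² (q(k) C(p,a) C(p,b) − q(k+1) C(p,a−1) C(p,b−1)),
-- so the sum of x(k) C(N,a) C(N,b) is N² q(0) C(p,n−ℓ) C(p,n+1) / c.
-- The third identity has c = N and q = 1; the first two have c = p and
-- q = p + (p − 2a)(p − 2b), with N = 2n + 3 and N = 2n + 4 respectively.
module Submission where

open import Defs
open import Data.Nat using (ℕ; zero; suc; _+_; _*_; _∸_; _^_; _≤_; NonZero)
open import Data.Nat.Properties
open import Data.Nat.Combinatorics using (_C_; nCk+nC[k+1]≡[n+1]C[k+1])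
open import Data.Nat.Tactic.RingSolver using (solve-∀)
open import Data.Integer using (+_)
import Data.Integer as ℤ
import Data.Integer.Properties as ℤ
open import Data.Rational using (ℚ; _/_) renaming (_*_ to _·_; _+_ to _⊕_)
open import Data.Rational.Properties using (fromℚᵘ-cong; toℚᵘ-fromℚᵘ; toℚᵘ-injective; toℚᵘ-homo-*; toℚᵘ-homo-+)
open import Data.Rational.Unnormalised using (mkℚᵘ; *≡*)
import Data.Rational.Unnormalised.Properties as ℚᵘ
open import Data.Product using (_×_; _,_)
open import Relation.Binary.PropositionalEquality using (_≡_; refl; sym; trans; cong; cong₂; module ≡-Reasoning)

-- Arithmetic of fractions

-- `_/_` reduces to lowest terms, so equality is checked on the unnormalised fractions, where it is
-- cross-multiplication; matching on `suc` exposes them.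
/-cross : ∀ a b c d .{{_ : NonZero b}} .{{_ : NonZero d}} →
          a * d ≡ c * b → + a / b ≡ + c / d
/-cross a (suc b) c (suc d) eq = fromℚᵘ-cong {mkℚᵘ (+ a) b} {mkℚᵘ (+ c) d}
  (*≡* (trans (sym (ℤ.pos-* a (suc d))) (trans (cong +_ eq) (ℤ.pos-* c (suc b)))))

/-·-/ : ∀ a b c d .{{_ : NonZero b}} .{{_ : NonZero d}} →
        (+ a / b) · (+ c / d) ≡ (+ (a * c) / (b * d)) {{m*n≢0 b d}}
/-·-/ a (suc b) c (suc d) = toℚᵘ-injective (begin
  _ ≈⟨ toℚᵘ-homo-* (+ a / suc b) (+ c / suc d) ⟩
  _ ≈⟨ ℚᵘ.*-cong (toℚᵘ-fromℚᵘ (mkℚᵘ (+ a) b)) (toℚᵘ-fromℚᵘ (mkℚᵘ (+ c) d)) ⟩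
  _ ≡⟨ cong (λ z → mkℚᵘ z (d + b * suc d)) (sym (ℤ.pos-* a c)) ⟩
  _ ≈⟨ toℚᵘ-fromℚᵘ (mkℚᵘ (+ (a * c)) (d + b * suc d)) ⟨
  _ ∎)
  where open ℚᵘ.≃-Reasoning

/-⊕-/ : ∀ a b c d .{{_ : NonZero b}} .{{_ : NonZero d}} →
        (+ a / b) ⊕ (+ c / d) ≡ (+ (a * d + c * b) / (b * d)) {{m*n≢0 b d}}
/-⊕-/ a (suc b) c (suc d) = toℚᵘ-injective (begin
  _ ≈⟨ toℚᵘ-homo-+ (+ a / suc b) (+ c / suc d) ⟩
  _ ≈⟨ ℚᵘ.+-cong (toℚᵘ-fromℚᵘ (mkℚᵘ (+ a) b)) (toℚᵘ-fromℚᵘ (mkℚᵘ (+ c) d)) ⟩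
  _ ≡⟨ cong (λ z → mkℚᵘ z (d + b * suc d))
         (trans (cong₂ ℤ._+_ (sym (ℤ.pos-* a (suc d))) (sym (ℤ.pos-* c (suc b))))
                (sym (ℤ.pos-+ (a * suc d) (c * suc b)))) ⟩
  _ ≈⟨ toℚᵘ-fromℚᵘ (mkℚᵘ (+ (a * suc d + c * suc b)) (d + b * suc d)) ⟨
  _ ∎)
  where open ℚᵘ.≃-Reasoning

/-·-fromℕ² : ∀ x D y z .{{_ : NonZero D}} →
             (+ x / D) · fromℕ y · fromℕ z ≡ + (x * y * z) / D
/-·-fromℕ² x D y z = begin
  (+ x / D) · fromℕ y · fromℕ z              ≡⟨ cong (_· fromℕ z) (/-·-/ x D y 1) ⟩
  (+ (x * y) / (D * 1)) · fromℕ z            ≡⟨ /-·-/ (x * y) (D * 1) z 1 ⟩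
  (+ (x * y * z) / (D * 1 * 1))              ≡⟨ /-cross (x * y * z) (D * 1 * 1) (x * y * z) D (eq (x * y * z) D) ⟩
  + (x * y * z) / D                          ∎
  where
  open ≡-Reasoning
  instance
    D1≢0 : NonZero (D * 1)
    D1≢0 = m*n≢0 D 1
    D11≢0 : NonZero (D * 1 * 1)
    D11≢0 = m*n≢0 (D * 1) 1
  eq : ∀ w D → w * D ≡ w * (D * 1 * 1)
  eq = solve-∀

-- Binomial coefficients

infixl 6.5 _C⁻_

-- n C⁻ k is the binomial coefficient of n and k − 1, which vanishes at k = 0.
_C⁻_ : ℕ → ℕ → ℕ
n C⁻ zero  = 0
n C⁻ suc k = n C k

pascal : ∀ n k → suc n C k ≡ n C⁻ k + n C k
pascal n zero    = refl
pascal n (suc k) = sym (nCk+nC[k+1]≡[n+1]C[k+1] n k)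

-- Induction on `n` by Pascal's rule: the hypotheses at `k` and `suc k` recombine into `suc n`
-- copies of `suc n C k`, and the copy split off by `expand` raises the factor to n + 2.
absorption : ∀ n k → k * (suc n C k) ≡ suc n * (n C⁻ k)
absorption n       zero          = sym (*-zeroʳ n)
absorption zero    (suc zero)    = refl
absorption zero    (suc (suc k)) = *-zeroʳ k
absorption (suc n) (suc k)       = begin
  suc k * (suc (suc n) C suc k)
    ≡⟨ cong (suc k *_) (pascal (suc n) (suc k)) ⟩
  suc k * (suc n C k + suc n C suc k)
    ≡⟨ expand k (suc n C k) (suc n C suc k) ⟩
  suc n C k + (k * (suc n C k) + suc k * (suc n C suc k))
    ≡⟨ cong (λ z → suc n C k + z) (cong₂ _+_ (absorption n k) (absorption n (suc k))) ⟩
  suc n C k + (suc n * (n C⁻ k) + suc n * (n C k))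
    ≡⟨ cong (λ z → suc n C k + z) (sym (*-distribˡ-+ (suc n) (n C⁻ k) (n C k))) ⟩
  suc n C k + suc n * (n C⁻ k + n C k)
    ≡⟨ cong (λ z → suc n C k + suc n * z) (sym (pascal n k)) ⟩
  suc (suc n) * (suc n C k) ∎
  where
  open ≡-Reasoning
  expand : ∀ k x y → suc k * (x + y) ≡ x + (k * x + suc k * y)
  expand = solve-∀

-- Adding `absorption` to both sides turns the claim into Pascal's rule multiplied by n + 1. Here
-- `e` is n + 1 - k, given by an equation to avoid truncated subtraction.
co-absorption : ∀ n k e → k + e ≡ suc n → e * (suc n C k) ≡ suc n * (n C k)
co-absorption n k e k+e≡1+n = +-cancelˡ-≡ (k * (suc n C k)) _ _ (begin
  k * (suc n C k) + e * (suc n C k)        ≡⟨ *-distribʳ-+ (suc n C k) k e ⟨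
  (k + e) * (suc n C k)                    ≡⟨ cong₂ _*_ k+e≡1+n (pascal n k) ⟩
  suc n * (n C⁻ k + n C k)                 ≡⟨ *-distribˡ-+ (suc n) (n C⁻ k) (n C k) ⟩
  suc n * (n C⁻ k) + suc n * (n C k)       ≡⟨ cong (_+ suc n * (n C k)) (absorption n k) ⟨
  k * (suc n C k) + suc n * (n C k)        ∎)
  where open ≡-Reasoning

-- One telescoping step, with the subtracted term moved to the left so that it stays in ℕ. Multiply
-- the polynomial hypothesis by C(N,a) C(N,b), where N = p + 1, e = N - a, f = N - b: absorption
-- rewrites the factors a, b and co-absorption the factors e, f.
C-step : ∀ p a b e f c x q q′ → a + e ≡ suc p → b + f ≡ suc p →
         c * x + a * b * q′ ≡ e * f * q →
         c * (x * (suc p C a) * (suc p C b)) + suc p * (p C⁻ a) * (suc p * (p C⁻ b)) * q′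
           ≡ suc p * (p C a) * (suc p * (p C b)) * q
C-step p a b e f c x q q′ a+e b+f eq = begin
  c * (x * A * B) + suc p * (p C⁻ a) * (suc p * (p C⁻ b)) * q′
    ≡⟨ cong (λ z → c * (x * A * B) + z * q′) (cong₂ _*_ (absorption p a) (absorption p b)) ⟨
  c * (x * A * B) + a * A * (b * B) * q′
    ≡⟨ collect c x A B a b q′ ⟩
  (c * x + a * b * q′) * (A * B)
    ≡⟨ cong (_* (A * B)) eq ⟩
  e * f * q * (A * B)
    ≡⟨ regroup e f q A B ⟩
  e * A * (f * B) * q
    ≡⟨ cong (_* q) (cong₂ _*_ (co-absorption p a e a+e) (co-absorption p b f b+f)) ⟩
  suc p * (p C a) * (suc p * (p C b)) * q ∎
  where
  open ≡-Reasoning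
  A = suc p C a
  B = suc p C b
  collect : ∀ c x A B a b q′ → c * (x * A * B) + a * A * (b * B) * q′ ≡ (c * x + a * b * q′) * (A * B)
  collect = solve-∀
  regroup : ∀ e f q A B → e * f * q * (A * B) ≡ e * A * (f * B) * q
  regroup = solve-∀

-- Telescoping sums

-- Since t/D = ct/(cD), the factor `c` goes into the common denominator and no division in ℕ occurs.
/-step : ∀ c D t u v .{{_ : NonZero c}} .{{_ : NonZero D}} → c * t + u ≡ v →
         (+ t / D) ⊕ (+ u / (c * D)) {{m*n≢0 c D}} ≡ (+ v / (c * D)) {{m*n≢0 c D}}
/-step c D t u v eq = trans (/-⊕-/ t D u (c * D)) (/-cross (t * (c * D) + u * D) (D * (c * D)) v (c * D) (begin
  (t * (c * D) + u * D) * (c * D)    ≡⟨ collect c D t u ⟩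
  (c * t + u) * (D * (c * D))        ≡⟨ cong (_* (D * (c * D))) eq ⟩
  v * (D * (c * D))                  ∎))
  where
  open ≡-Reasoning
  instance
    cD≢0 : NonZero (c * D)
    cD≢0 = m*n≢0 c D
    DcD≢0 : NonZero (D * (c * D))
    DcD≢0 = m*n≢0 D (c * D)
  collect : ∀ c D t u → (t * (c * D) + u * D) * (c * D) ≡ (c * t + u) * (D * (c * D))
  collect = solve-∀

-- The argument a of t and U is the distance m − k from the top index, so that
-- no truncated subtraction occurs.
∑-telescope : ∀ c D .{{_ : NonZero c}} .{{_ : NonZero D}} m (f : ℕ → ℚ) (t U : ℕ → ℕ → ℕ) →
  (∀ k a → k + a ≡ m → f k ≡ + t k a / D) →
  (∀ k a → k + a ≡ m → c * t k a + U (suc k) a ≡ U k (suc a)) →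
  U (suc m) 0 ≡ 0 →
  (∑[ k ≤ m ] f k) ≡ (+ U 0 (suc m) / (c * D)) {{m*n≢0 c D}}
∑-telescope c D zero f t U f≡t/D step U≡0 =
  -- The sum over one index ends in the empty sum 0, which is read as the vanishing boundary value
  -- `U 1 0` over `c * D`.
  trans (cong₂ _⊕_ (f≡t/D 0 0 refl) (/-cross 0 1 (U 1 0) (c * D) (sym (cong (_* 1) U≡0))))
        (/-step c D (t 0 0) (U 1 0) (U 0 1) (step 0 0 refl))
  where
  instance
    cD≢0 : NonZero (c * D)
    cD≢0 = m*n≢0 c D
∑-telescope c D (suc m) f t U f≡t/D step U≡0 =
  trans (cong₂ _⊕_ (f≡t/D 0 (suc m) refl)
          -- The tail is the same kind of sum with k shifted by one; the distance to the top index
          -- is unchanged.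
          (∑-telescope c D m (λ k → f (suc k)) (λ k → t (suc k)) (λ k → U (suc k))
            (λ k a k+a≡m → f≡t/D (suc k) a (cong suc k+a≡m))
            (λ k a k+a≡m → step (suc k) a (cong suc k+a≡m)) U≡0))
        (/-step c D (t 0 (suc m)) (U 1 (suc m)) (U 0 (2 + m)) (step 0 (suc m) refl))

-- Common form of the three identities: `s` is 0 for N = 2n + 3 and 1 for N = 2n + 4, and X/Y is the
-- left-hand side. With a = m - k and b = a + ℓ + 1, the two long factors in the hypothesis on `q`
-- are N - a and N - b; the last hypothesis is the closed form, cross-multiplied.
∑-binomial-products : ∀ s ℓ m n p N c D X Y .{{_ : NonZero c}} .{{_ : NonZero D}} .{{_ : NonZero Y}}
  (x q : ℕ → ℕ) → ℓ + m ≡ n → p ≡ s + (2 + 2 * n) → N ≡ suc p →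
  (∀ k a → k + a ≡ m →
    c * x k + a * (a + suc ℓ) * q (suc k)
      ≡ (s + 2 * k + 2 * suc ℓ + a + 1) * (s + 2 * k + suc ℓ + a + 1) * q k) →
  X * (c * D) ≡ N * (p C m) * (N * (p C suc n)) * q 0 * Y →
  + X / Y ≡ (∑[ k ≤ m ] ((+ x k / D) · fromℕ (N C (n ∸ k ∸ ℓ)) · fromℕ (N C (n ∸ k + 1))))
∑-binomial-products s ℓ m _ _ _ c D X Y x q refl refl refl eq X/Y = sym (trans
  (∑-telescope c D m f t U term step
    -- The upper boundary term contains C(p, -1), that is `p C⁻ 0`, and so vanishes.
    (cong (λ z → z * (suc p * (p C⁻ suc ℓ)) * q (suc m)) (*-zeroʳ (suc p))))
  (/-cross (U 0 (suc m)) (c * D) X Y (sym (trans X/Y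
    (cong (λ b → suc p * (p C m) * (suc p * (p C b)) * q 0 * Y) (+-comm (suc ℓ) m))))))
  where
  instance
    cD≢0 : NonZero (c * D)
    cD≢0 = m*n≢0 c D
  p = s + (2 + 2 * (ℓ + m))
  f : ℕ → ℚ
  f k = (+ x k / D) · fromℕ (suc p C (ℓ + m ∸ k ∸ ℓ)) · fromℕ (suc p C (ℓ + m ∸ k + 1))
  t U : ℕ → ℕ → ℕ
  t k a = x k * (suc p C a) * (suc p C (a + suc ℓ))
  -- At index k the telescoping takes this at m + 1 - k, so the value there is N² C(p, m - k) C(p, m
  -- - k + ℓ + 1) q(k).
  U k a = suc p * (p C⁻ a) * (suc p * (p C⁻ (a + suc ℓ))) * q k

  n∸k : ∀ k a → k + a ≡ m → ℓ + m ∸ k ≡ ℓ + a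
  n∸k k a refl = trans (cong (_∸ k) (swap ℓ k a)) (m+n∸m≡n k (ℓ + a))
    where
    swap : ∀ ℓ k a → ℓ + (k + a) ≡ k + (ℓ + a)
    swap = solve-∀

  -- Here the truncated subtractions are resolved: for k + a = m the lower indices are a and a + ℓ +
  -- 1.
  term : ∀ k a → k + a ≡ m → f k ≡ + t k a / D
  term k a k+a≡m = trans
    (cong₂ (λ a b → (+ x k / D) · fromℕ (suc p C a) · fromℕ (suc p C b))
      (trans (cong (_∸ ℓ) (n∸k k a k+a≡m)) (m+n∸m≡n ℓ a))
      (trans (cong (_+ 1) (n∸k k a k+a≡m)) (swap ℓ a)))
    (/-·-fromℕ² (x k) D (suc p C a) (suc p C (a + suc ℓ)))
    where
    swap : ∀ ℓ a → ℓ + a + 1 ≡ a + suc ℓ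
    swap = solve-∀

  step : ∀ k a → k + a ≡ m → c * t k a + U (suc k) a ≡ U k (suc a)
  -- `U k (suc a)` unfolds to the ordinary coefficients C(p,a) C(p,b), as `C⁻` at a successor lowers
  -- the index by one.
  step k a k+a≡m = C-step p a (a + suc ℓ) _ _ c (x k) (q k) (q (suc k))
    (trans (aComplement s ℓ k a) (cong (λ m → suc (s + (2 + 2 * (ℓ + m)))) k+a≡m))
    (trans (bComplement s ℓ k a) (cong (λ m → suc (s + (2 + 2 * (ℓ + m)))) k+a≡m))
    (eq k a k+a≡m)
    where
    aComplement : ∀ s ℓ k a → a + (s + 2 * k + 2 * suc ℓ + a + 1) ≡ suc (s + (2 + 2 * (ℓ + (k + a))))
    aComplement = solve-∀
    bComplement : ∀ s ℓ k a → a + suc ℓ + (s + 2 * k + suc ℓ + a + 1) ≡ suc (s + (2 + 2 * (ℓ + (k + a))))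
    bComplement = solve-∀

-- Central binomial coefficients and products of fractions

central : ∀ n → suc n * ((2 + 2 * n) C suc n) ≡ (2 + 2 * n) * ((1 + 2 * n) C n)
central n = absorption (1 + 2 * n) (suc n)

subcentral : ∀ n → suc n * ((1 + 2 * n) C n) ≡ (1 + 2 * n) * ((2 * n) C n)
subcentral n = co-absorption (2 * n) n (suc n) (n+[1+n] n)
  where
  n+[1+n] : ∀ n → n + suc n ≡ suc (2 * n)
  n+[1+n] = solve-∀

supercentral : ∀ n → (2 + n) * ((3 + 2 * n) C suc n) ≡ (3 + 2 * n) * ((2 + 2 * n) C suc n)
supercentral n = co-absorption (2 + 2 * n) (suc n) (2 + n) (complement n)
  where
  complement : ∀ n → suc n + (2 + n) ≡ 3 + 2 * n
  complement = solve-∀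

fraction-product : ∀ u v A B .{{_ : NonZero u}} .{{_ : NonZero v}} →
  (+ 1 / u) · fromℕ A · ((+ 1 / v) · fromℕ B) ≡ (+ (A * B) / (u * v)) {{m*n≢0 u v}}
fraction-product u v A B = begin
  (+ 1 / u) · fromℕ A · ((+ 1 / v) · fromℕ B)
    ≡⟨ cong₂ _·_ (/-·-/ 1 u A 1) (/-·-/ 1 v B 1) ⟩
  (+ (1 * A) / (u * 1)) · (+ (1 * B) / (v * 1))
    ≡⟨ /-·-/ (1 * A) (u * 1) (1 * B) (v * 1) ⟩
  + (1 * A * (1 * B)) / (u * 1 * (v * 1))
    ≡⟨ /-cross (1 * A * (1 * B)) (u * 1 * (v * 1)) (A * B) (u * v) (eq u v A B) ⟩
  + (A * B) / (u * v) ∎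
  where
  open ≡-Reasoning
  instance
    u1≢0 : NonZero (u * 1)
    u1≢0 = m*n≢0 u 1
    v1≢0 : NonZero (v * 1)
    v1≢0 = m*n≢0 v 1
    u1v1≢0 : NonZero (u * 1 * (v * 1))
    u1v1≢0 = m*n≢0 (u * 1) (v * 1)
    uv≢0 : NonZero (u * v)
    uv≢0 = m*n≢0 u v
  eq : ∀ u v A B → 1 * A * (1 * B) * (u * v) ≡ A * B * (u * 1 * (v * 1))
  eq = solve-∀

-- The three identities, with m = n - ℓ

identity₁ : ∀ ℓ m n → ℓ + m ≡ n →
  (+ 1 / (1 + n)) · fromℕ ((2 + 2 * n) C m) · catalan n
    ≡ (∑[ k ≤ m ]
        ((+ ((1 + 2 * k) * (2 + 2 * k + ℓ) * (3 + 2 * k + 2 * ℓ))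
            / ((1 + 2 * n) * (2 + 2 * n) * (3 + 2 * n) ^ 2))
          · fromℕ ((3 + 2 * n) C (n ∸ k ∸ ℓ))
          · fromℕ ((3 + 2 * n) C (n ∸ k + 1))))
identity₁ ℓ m n ℓ+m≡n = trans
  (fraction-product (1 + n) (suc n) ((2 + 2 * n) C m) ((2 * n) C n))
  (∑-binomial-products 0 ℓ m n (2 + 2 * n) (3 + 2 * n)
    (2 + 2 * n) ((1 + 2 * n) * (2 + 2 * n) * (3 + 2 * n) ^ 2)
    (((2 + 2 * n) C m) * ((2 * n) C n)) ((1 + n) * suc n)
    -- These factors are N - 2b, N - a - b and N - 2a.
    (λ k → (1 + 2 * k) * (2 + 2 * k + ℓ) * (3 + 2 * k + 2 * ℓ))
    -- Here p - 2b = 2k and p - 2a = 2k + 2ℓ + 2, so q(0) is just p = 2n + 2.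
    (λ k → 2 * k * (2 + 2 * k + 2 * ℓ) + (2 + 2 * n))
    ℓ+m≡n refl refl (q-step ℓ m n ℓ+m≡n)
    (cross ((2 + 2 * n) C m) ((2 * n) C n) ((1 + 2 * n) C n) ((2 + 2 * n) C suc n)
      (2 * 0 * (2 + 2 * 0 + 2 * ℓ) + (2 + 2 * n)) n refl (central n) (subcentral n)))
  where
  q-step : ∀ ℓ m n → ℓ + m ≡ n → ∀ k a → k + a ≡ m →
    (2 + 2 * n) * ((1 + 2 * k) * (2 + 2 * k + ℓ) * (3 + 2 * k + 2 * ℓ))
      + a * (a + suc ℓ) * (2 * suc k * (2 + 2 * suc k + 2 * ℓ) + (2 + 2 * n))
    ≡ (0 + 2 * k + 2 * suc ℓ + a + 1) * (0 + 2 * k + suc ℓ + a + 1)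
      * (2 * k * (2 + 2 * k + 2 * ℓ) + (2 + 2 * n))
  -- Eliminating m and n leaves a polynomial identity in ℓ, k, a.
  q-step ℓ _ _ refl k a refl = poly ℓ k a
    where
    poly : ∀ ℓ k a →
      (2 + 2 * (ℓ + (k + a))) * ((1 + 2 * k) * (2 + 2 * k + ℓ) * (3 + 2 * k + 2 * ℓ))
        + a * (a + suc ℓ) * (2 * suc k * (2 + 2 * suc k + 2 * ℓ) + (2 + 2 * (ℓ + (k + a))))
      ≡ (0 + 2 * k + 2 * suc ℓ + a + 1) * (0 + 2 * k + suc ℓ + a + 1)
        * (2 * k * (2 + 2 * k + 2 * ℓ) + (2 + 2 * (ℓ + (k + a))))
    poly = solve-∀

  -- `B`, `B′`, `B″` stand for the central coefficients in rows 2n, 2n + 1, 2n + 2. Each move up one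
  -- row yields a factor n + 1, and the two factors make up the denominator (n + 1)² of the
  -- left-hand side.
  cross : ∀ A B B′ B″ q₀ n → q₀ ≡ 2 + 2 * n →
    suc n * B″ ≡ (2 + 2 * n) * B′ → suc n * B′ ≡ (1 + 2 * n) * B →
    A * B * ((2 + 2 * n) * ((1 + 2 * n) * (2 + 2 * n) * (3 + 2 * n) ^ 2))
      ≡ (3 + 2 * n) * A * ((3 + 2 * n) * B″) * q₀ * ((1 + n) * suc n)
  cross A B B′ B″ _ n refl eq″ eq′ = begin
    A * B * ((2 + 2 * n) * ((1 + 2 * n) * (2 + 2 * n) * (3 + 2 * n) ^ 2))
      ≡⟨ left A B (1 + 2 * n) (2 + 2 * n) (3 + 2 * n) ⟩
    F * ((2 + 2 * n) * ((1 + 2 * n) * B))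
      ≡⟨ cong (λ z → F * ((2 + 2 * n) * z)) eq′ ⟨
    F * ((2 + 2 * n) * (suc n * B′))
      ≡⟨ middle F (2 + 2 * n) (suc n) B′ ⟩
    F * (suc n * ((2 + 2 * n) * B′))
      ≡⟨ cong (λ z → F * (suc n * z)) eq″ ⟨
    F * (suc n * (suc n * B″))
      ≡⟨ right A B″ (suc n) (2 + 2 * n) (3 + 2 * n) ⟩
    (3 + 2 * n) * A * ((3 + 2 * n) * B″) * (2 + 2 * n) * ((1 + n) * suc n) ∎
    where
    open ≡-Reasoning
    F = (3 + 2 * n) * (3 + 2 * n) * (2 + 2 * n) * A
    -- `N * (N * 1)` is the unfolding of the square in the denominator.
    left : ∀ A B r p N → A * B * (p * (r * p * (N * (N * 1)))) ≡ N * N * p * A * (p * (r * B))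
    left = solve-∀
    middle : ∀ F p u B → F * (p * (u * B)) ≡ F * (u * (p * B))
    middle = solve-∀
    right : ∀ A B u p N → N * N * p * A * (u * (u * B)) ≡ N * A * (N * B) * p * (u * u)
    right = solve-∀

identity₂ : ∀ ℓ m n → ℓ + m ≡ n →
  (+ 1 / (1 + n)) · fromℕ ((2 + 2 * n) C m) · catalan (1 + n)
    ≡ (∑[ k ≤ m ]
        ((+ ((2 + 2 * k) * (3 + 2 * k + ℓ) * (4 + 2 * k + 2 * ℓ))
            / ((2 + 2 * n) * (3 + 2 * n) * (4 + 2 * n) ^ 2))
          · fromℕ ((4 + 2 * n) C (n ∸ k ∸ ℓ))
          · fromℕ ((4 + 2 * n) C (n ∸ k + 1))))
identity₂ ℓ m n ℓ+m≡n = trans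
  (fraction-product (1 + n) (suc (1 + n)) ((2 + 2 * n) C m) ((2 * (1 + n)) C (1 + n)))
  (∑-binomial-products 1 ℓ m n (3 + 2 * n) (4 + 2 * n)
    (3 + 2 * n) ((2 + 2 * n) * (3 + 2 * n) * (4 + 2 * n) ^ 2)
    (((2 + 2 * n) C m) * ((2 * (1 + n)) C (1 + n))) ((1 + n) * suc (1 + n))
    (λ k → (2 + 2 * k) * (3 + 2 * k + ℓ) * (4 + 2 * k + 2 * ℓ))
    -- Here p - 2b = 2k + 1 and p - 2a = 2k + 2ℓ + 3, so q(0) does not reduce to p.
    (λ k → (1 + 2 * k) * (3 + 2 * k + 2 * ℓ) + (3 + 2 * n))
    ℓ+m≡n refl refl (q-step ℓ m n ℓ+m≡n)
    (cross ((2 + 2 * n) C m) ((3 + 2 * n) C m) ((2 * (1 + n)) C (1 + n)) ((3 + 2 * n) C suc n)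
      ((1 + 2 * 0) * (3 + 2 * 0 + 2 * ℓ) + (3 + 2 * n)) n (q₀-absorption ℓ m n ℓ+m≡n)
      (trans (supercentral n)
        -- `catalan (1 + n)` has upper index `2 * (1 + n)`, which is not definitionally `2 + 2 * n`.
        (cong (λ r → (3 + 2 * n) * (r C suc n)) (sym (*-suc 2 n))))))
  where
  open ≡-Reasoning
  q-step : ∀ ℓ m n → ℓ + m ≡ n → ∀ k a → k + a ≡ m →
    (3 + 2 * n) * ((2 + 2 * k) * (3 + 2 * k + ℓ) * (4 + 2 * k + 2 * ℓ))
      + a * (a + suc ℓ) * ((1 + 2 * suc k) * (3 + 2 * suc k + 2 * ℓ) + (3 + 2 * n))
    ≡ (1 + 2 * k + 2 * suc ℓ + a + 1) * (1 + 2 * k + suc ℓ + a + 1)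
      * ((1 + 2 * k) * (3 + 2 * k + 2 * ℓ) + (3 + 2 * n))
  q-step ℓ _ _ refl k a refl = poly ℓ k a
    where
    poly : ∀ ℓ k a →
      (3 + 2 * (ℓ + (k + a))) * ((2 + 2 * k) * (3 + 2 * k + ℓ) * (4 + 2 * k + 2 * ℓ))
        + a * (a + suc ℓ) * ((1 + 2 * suc k) * (3 + 2 * suc k + 2 * ℓ) + (3 + 2 * (ℓ + (k + a))))
      ≡ (1 + 2 * k + 2 * suc ℓ + a + 1) * (1 + 2 * k + suc ℓ + a + 1)
        * ((1 + 2 * k) * (3 + 2 * k + 2 * ℓ) + (3 + 2 * (ℓ + (k + a))))
    poly = solve-∀

  -- The value q(0) = 2(n + ℓ + 3) is 2(p - m) with p = 2n + 3, so co-absorption lowers C(p,m) to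
  -- row 2n + 2, the row on the left-hand side.
  q₀-absorption : ∀ ℓ m n → ℓ + m ≡ n →
    ((1 + 2 * 0) * (3 + 2 * 0 + 2 * ℓ) + (3 + 2 * n)) * ((3 + 2 * n) C m)
      ≡ 2 * ((3 + 2 * n) * ((2 + 2 * n) C m))
  q₀-absorption ℓ m n ℓ+m≡n = begin
    ((1 + 2 * 0) * (3 + 2 * 0 + 2 * ℓ) + (3 + 2 * n)) * ((3 + 2 * n) C m)
      ≡⟨ cong (_* ((3 + 2 * n) C m)) (double ℓ m n ℓ+m≡n) ⟩
    2 * (3 + 2 * ℓ + m) * ((3 + 2 * n) C m)
      ≡⟨ *-assoc 2 (3 + 2 * ℓ + m) ((3 + 2 * n) C m) ⟩
    2 * ((3 + 2 * ℓ + m) * ((3 + 2 * n) C m))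
      ≡⟨ cong (2 *_) (co-absorption (2 + 2 * n) m (3 + 2 * ℓ + m) (complement ℓ m n ℓ+m≡n)) ⟩
    2 * ((3 + 2 * n) * ((2 + 2 * n) C m)) ∎
    where
    double : ∀ ℓ m n → ℓ + m ≡ n →
      (1 + 2 * 0) * (3 + 2 * 0 + 2 * ℓ) + (3 + 2 * n) ≡ 2 * (3 + 2 * ℓ + m)
    double ℓ m _ refl = poly ℓ m
      where
      poly : ∀ ℓ m → (1 + 2 * 0) * (3 + 2 * 0 + 2 * ℓ) + (3 + 2 * (ℓ + m)) ≡ 2 * (3 + 2 * ℓ + m)
      poly = solve-∀
    complement : ∀ ℓ m n → ℓ + m ≡ n → m + (3 + 2 * ℓ + m) ≡ 3 + 2 * n
    complement ℓ m _ refl = poly ℓ m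
      where
      poly : ∀ ℓ m → m + (3 + 2 * ℓ + m) ≡ 3 + 2 * (ℓ + m)
      poly = solve-∀

  cross : ∀ A A′ B B′ q₀ n →
    q₀ * A′ ≡ 2 * ((3 + 2 * n) * A) → (2 + n) * B′ ≡ (3 + 2 * n) * B →
    A * B * ((3 + 2 * n) * ((2 + 2 * n) * (3 + 2 * n) * (4 + 2 * n) ^ 2))
      ≡ (4 + 2 * n) * A′ * ((4 + 2 * n) * B′) * q₀ * ((1 + n) * suc (1 + n))
  cross A A′ B B′ q₀ n eqA eqB = begin
    A * B * ((3 + 2 * n) * ((2 + 2 * n) * (3 + 2 * n) * (4 + 2 * n) ^ 2))
      ≡⟨ left A B n (3 + 2 * n) (4 + 2 * n) ⟩
    F * (2 * ((3 + 2 * n) * A) * ((3 + 2 * n) * B))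
      ≡⟨ cong (F *_) (cong₂ _*_ eqA eqB) ⟨
    F * (q₀ * A′ * ((2 + n) * B′))
      ≡⟨ right A′ B′ q₀ (1 + n) (2 + n) (4 + 2 * n) ⟩
    (4 + 2 * n) * A′ * ((4 + 2 * n) * B′) * q₀ * ((1 + n) * suc (1 + n)) ∎
    where
    F = (4 + 2 * n) * (4 + 2 * n) * (1 + n)
    -- `n` stays explicit because 2n + 2 must split into the 2 from q(0) and the n + 1 from the
    -- denominator.
    left : ∀ A B n p N → A * B * (p * ((2 + 2 * n) * p * (N * (N * 1))))
      ≡ N * N * (1 + n) * (2 * (p * A) * (p * B))
    left = solve-∀
    right : ∀ A B q u v N → N * N * u * (q * A * (v * B)) ≡ N * A * (N * B) * q * (u * v)
    right = solve-∀

-- The numerator is N - a - b, and N(N - a - b) + ab = (N - a)(N - b), so a constant `q` suffices.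
identity₃ : ∀ ℓ m n → ℓ + m ≡ n →
  (+ 1 / (1 + n)) · fromℕ ((2 + 2 * n) C m) · fromℕ ((1 + 2 * n) C n)
    ≡ (∑[ k ≤ m ]
        ((+ (2 + 2 * k + ℓ)
            / ((2 + 2 * n) * (3 + 2 * n)))
          · fromℕ ((3 + 2 * n) C (n ∸ k ∸ ℓ))
          · fromℕ ((3 + 2 * n) C (n ∸ k + 1))))
identity₃ ℓ m n ℓ+m≡n = trans
  (/-·-fromℕ² 1 (1 + n) ((2 + 2 * n) C m) ((1 + 2 * n) C n))
  (∑-binomial-products 0 ℓ m n (2 + 2 * n) (3 + 2 * n)
    (3 + 2 * n) ((2 + 2 * n) * (3 + 2 * n))
    (1 * ((2 + 2 * n) C m) * ((1 + 2 * n) C n)) (1 + n)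
    (λ k → 2 + 2 * k + ℓ) (λ _ → 1)
    ℓ+m≡n refl refl (q-step ℓ m n ℓ+m≡n)
    (cross ((2 + 2 * n) C m) ((1 + 2 * n) C n) ((2 + 2 * n) C suc n) (1 + n) (2 + 2 * n) (3 + 2 * n)
      (central n)))
  where
  q-step : ∀ ℓ m n → ℓ + m ≡ n → ∀ k a → k + a ≡ m →
    (3 + 2 * n) * (2 + 2 * k + ℓ) + a * (a + suc ℓ) * 1
      ≡ (0 + 2 * k + 2 * suc ℓ + a + 1) * (0 + 2 * k + suc ℓ + a + 1) * 1
  q-step ℓ _ _ refl k a refl = poly ℓ k a
    where
    poly : ∀ ℓ k a → (3 + 2 * (ℓ + (k + a))) * (2 + 2 * k + ℓ) + a * (a + suc ℓ) * 1
      ≡ (0 + 2 * k + 2 * suc ℓ + a + 1) * (0 + 2 * k + suc ℓ + a + 1) * 1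
    poly = solve-∀

  cross : ∀ A B B′ u p N → u * B′ ≡ p * B →
    1 * A * B * (N * (p * N)) ≡ N * A * (N * B′) * 1 * u
  cross A B B′ u p N eq = begin
    1 * A * B * (N * (p * N))   ≡⟨ left A B p N ⟩
    N * N * A * (p * B)         ≡⟨ cong (N * N * A *_) eq ⟨
    N * N * A * (u * B′)        ≡⟨ right A B′ u N ⟩
    N * A * (N * B′) * 1 * u    ∎
    where
    open ≡-Reasoning
    left : ∀ A B p N → 1 * A * B * (N * (p * N)) ≡ N * N * A * (p * B)
    left = solve-∀
    right : ∀ A B u N → N * N * A * (u * B) ≡ N * A * (N * B) * 1 * u
    right = solve-∀

corollary3p9 : (n ℓ : ℕ) → ℓ ≤ n →
  ((+ 1 / (1 + n)) · fromℕ ((2 + 2 * n) C (n ∸ ℓ)) · catalan n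
    ≡ (∑[ k ≤ n ∸ ℓ ]
        ((+ ((1 + 2 * k) * (2 + 2 * k + ℓ) * (3 + 2 * k + 2 * ℓ))
            / ((1 + 2 * n) * (2 + 2 * n) * (3 + 2 * n) ^ 2))
          · fromℕ ((3 + 2 * n) C (n ∸ k ∸ ℓ))
          · fromℕ ((3 + 2 * n) C (n ∸ k + 1)))))
  × ((+ 1 / (1 + n)) · fromℕ ((2 + 2 * n) C (n ∸ ℓ)) · catalan (1 + n)
    ≡ (∑[ k ≤ n ∸ ℓ ]
        ((+ ((2 + 2 * k) * (3 + 2 * k + ℓ) * (4 + 2 * k + 2 * ℓ))
            / ((2 + 2 * n) * (3 + 2 * n) * (4 + 2 * n) ^ 2))
          · fromℕ ((4 + 2 * n) C (n ∸ k ∸ ℓ))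
          · fromℕ ((4 + 2 * n) C (n ∸ k + 1)))))
  × ((+ 1 / (1 + n)) · fromℕ ((2 + 2 * n) C (n ∸ ℓ)) · fromℕ ((1 + 2 * n) C n)
    ≡ (∑[ k ≤ n ∸ ℓ ]
        ((+ (2 + 2 * k + ℓ)
            / ((2 + 2 * n) * (3 + 2 * n)))
          · fromℕ ((3 + 2 * n) C (n ∸ k ∸ ℓ))
          · fromℕ ((3 + 2 * n) C (n ∸ k + 1)))))
corollary3p9 n ℓ ℓ≤n =
    identity₁ ℓ (n ∸ ℓ) n (m+[n∸m]≡n ℓ≤n)
  , identity₂ ℓ (n ∸ ℓ) n (m+[n∸m]≡n ℓ≤n)
  , identity₃ ℓ (n ∸ ℓ) n (m+[n∸m]≡n ℓ≤n)
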